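{- Let $C_{(<,>)}(x,y)$ be the bivariate generating function of the Catalan words avoiding the ordered pair of relations $(<,>)$, where $x$ marks the length and $y$ marks the number of descents. Then $$C_{(<,>)}(x,y)=\frac{1 - 2 x + 2 x y - x^2 y - \sqrt{1 - 4 x + 4 x^2 - 2 x^2 y + x^4 y^2}}{2 x y (1 - x)}.$$
   Context: A Catalan word of length $n$ is a word $w=w_1w_2\cdots w_n$ over the non-negative integers with $w_1=0$ and $0\leq w_i\leq w_{i-1}+1$ for $i=2,\dots,n$; the empty word is the unique Catalan word of length $0$. For relations $X,Y\in\{<,>,\leq,\geq,=,\neq\}$, a word $w$ contains the pattern $(X,Y)$ if there is an index $i\geq 1$ (with $i+2\le n$) such that $w_i\,X\,w_{i+1}$ and $w_{i+1}\,Y\,w_{i+2}$; otherwise $w$ avoids $(X,Y)$. The number of descents $\mathrm{des}(w)$ is the number of indices $i$ with $w_i>w_{i+1}$. The bivariate generating function is $C_{(X,Y)}(x,y)=\sum_{w}x^{|w|}y^{\mathrm{des}(w)}$, the sum being over all Catalan words $w$ (of any length $|w|\geq 0$) avoiding $(X,Y)$. Identities are between formal power series in $x$ with coefficients polynomials in $y$ (after clearing denominators); the square root of a power series with constant term $1$ is the one with constant term $1$. -}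

module Defs where

open import Data.Bool.Base using (if_then_else_)
open import Data.Integer.Base as ℤ using (ℤ; 0ℤ; 1ℤ)
open import Data.List.Base
  using (List; []; _∷_; [_]; _++_; map; foldr; filter; length; replicate; upTo;
         cartesianProductWith)
open import Data.List.Membership.Propositional using (_∈_)
open import Data.List.Membership.Propositional.Properties
  using (∈-filter⁺; ∈-filter⁻; ∈-upTo⁺; ∈-cartesianProductWith⁺;
         ∈-cartesianProductWith⁻)
open import Data.List.Properties using (∷-injective)
open import Data.List.Relation.Unary.All using (All; []; _∷_)
open import Data.List.Relation.Unary.AllPairs using ([]; _∷_)
open import Data.List.Relation.Unary.Any using (here)
open import Data.List.Relation.Unary.Linked using (Linked; []; [-]; _∷_; linked?)
open import Data.List.Relation.Unary.Unique.Propositional using (Unique)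
import Data.List.Relation.Unary.Unique.Propositional.Properties as Unique
open import Data.Nat.Base using (ℕ; zero; suc; _+_; _∸_; _≤_; _<_)
open import Data.Nat.Properties
  using (_≤?_; _>?_; ≤-trans; ≤-reflexive; m≤m+n; +-suc; +-identityʳ; +-monoˡ-≤)
open import Data.Product.Base using (_×_; _,_)
open import Level using (0ℓ)
open import Relation.Binary.Core using (Rel)
open import Relation.Binary.Definitions using (Decidable)
open import Relation.Binary.PropositionalEquality
  using (_≡_; refl; sym; cong; subst)
open import Relation.Nullary using (¬_; Dec; yes; no; does; ¬?)
open import Relation.Nullary.Decidable using (map′; _×-dec_; _⊎-dec_)
open import Data.Sum.Base using (inj₁; inj₂; [_,_]′)

------------------------------------------------------------------------
-- Catalan words

Word : Set
Word = List ℕ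

data IsCatalan : Word → Set where
  empty : IsCatalan []
  start : ∀ {w} → Linked (λ a b → b ≤ suc a) (0 ∷ w) → IsCatalan (0 ∷ w)

isCatalan? : ∀ w → Dec (IsCatalan w)
isCatalan? []          = yes empty
isCatalan? (zero ∷ w)  =
  map′ start (λ { (start l) → l }) (linked? (λ a b → b ≤? suc a) (0 ∷ w))
isCatalan? (suc _ ∷ _) = no λ ()

data Contains (X Y : Rel ℕ 0ℓ) : Word → Set where
  here  : ∀ {a b c w} → X a b → Y b c → Contains X Y (a ∷ b ∷ c ∷ w)
  there : ∀ {a w} → Contains X Y w → Contains X Y (a ∷ w)

Avoids : (X Y : Rel ℕ 0ℓ) → Word → Set
Avoids X Y w = ¬ Contains X Y w

module _ {X Y : Rel ℕ 0ℓ} (X? : Decidable X) (Y? : Decidable Y) where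

  contains? : ∀ w → Dec (Contains X Y w)
  contains? []               = no λ ()
  contains? (_ ∷ [])         = no λ { (there ()) }
  contains? (_ ∷ _ ∷ [])     = no λ { (there (there ())) }
  contains? (a ∷ b ∷ c ∷ w) =
    map′ [ (λ { (p , q) → here p q }) , there ]′
         (λ { (here p q) → inj₁ (p , q) ; (there r) → inj₂ r })
         ((X? a b ×-dec Y? b c) ⊎-dec contains? (b ∷ c ∷ w))

  avoids? : ∀ w → Dec (Avoids X Y w)
  avoids? w = ¬? (contains? w)

des : Word → ℕ
des []          = 0
des (_ ∷ [])    = 0
des (a ∷ b ∷ w) = (if does (a >? b) then 1 else 0) + des (b ∷ w)

-- All words of length n over the alphabet {0, …, m - 1}.
wordsBelow : ℕ → ℕ → List Word
wordsBelow m zero    = [ [] ]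
wordsBelow m (suc n) = cartesianProductWith _∷_ (upTo m) (wordsBelow m n)

-- The letters of a Catalan word of length n are smaller than n, so this lists
-- every Catalan word of length n exactly once (see the three lemmas below).
catalanWords : ℕ → List Word
catalanWords n = filter isCatalan? (wordsBelow n n)

private
  length-wordsBelow : ∀ m n {w} → w ∈ wordsBelow m n → length w ≡ n
  length-wordsBelow m zero    (here refl) = refl
  length-wordsBelow m (suc n) w∈
    with ∈-cartesianProductWith⁻ _∷_ (upTo m) (wordsBelow m n) w∈
  ... | _ , _ , _ , v∈ , refl = cong suc (length-wordsBelow m n v∈)

  ∈-wordsBelow : ∀ m {w} → All (_< m) w → w ∈ wordsBelow m (length w)
  ∈-wordsBelow m []        = here refl
  ∈-wordsBelow m (a< ∷ w<) =
    ∈-cartesianProductWith⁺ _∷_ (∈-upTo⁺ a<) (∈-wordsBelow m w<)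

  wordsBelow-unique : ∀ m n → Unique (wordsBelow m n)
  wordsBelow-unique m zero    = [] ∷ []
  wordsBelow-unique m (suc n) =
    Unique.cartesianProductWith⁺ _∷_ ∷-injective
      (Unique.upTo⁺ m) (wordsBelow-unique m n)

  letters< : ∀ {a w} m → Linked (λ a b → b ≤ suc a) (a ∷ w) →
             a + length (a ∷ w) ≤ m → All (_< m) (a ∷ w)
  letters< {a} m [-] h =
    subst (_≤ m) (+-suc-zero a) h ∷ []
    where
    +-suc-zero : ∀ a → a + 1 ≡ suc a
    +-suc-zero a rewrite +-suc a 0 | +-identityʳ a = refl
  letters< {a} {b ∷ w} m (b≤ ∷ l) h =
    ≤-trans (m≤m+n (suc a) (length (b ∷ w))) h′
      ∷ letters< m l (≤-trans (+-monoˡ-≤ (length (b ∷ w)) b≤) h′)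
    where
    h′ : suc a + length (b ∷ w) ≤ m
    h′ = ≤-trans (≤-reflexive (sym (+-suc a (length (b ∷ w))))) h

catalanWords-sound : ∀ {n w} → w ∈ catalanWords n → IsCatalan w × length w ≡ n
catalanWords-sound {n} w∈ with ∈-filter⁻ isCatalan? {xs = wordsBelow n n} w∈
... | w∈′ , c = c , length-wordsBelow n n w∈′

catalanWords-complete : ∀ {w} → IsCatalan w → w ∈ catalanWords (length w)
catalanWords-complete {w} c =
  ∈-filter⁺ isCatalan? (∈-wordsBelow (length w) (bound c)) c
  where
  bound : ∀ {w} → IsCatalan w → All (_< length w) w
  bound empty         = []
  bound (start {w} l) = letters< (suc (length w)) l (≤-reflexive refl)

catalanWords-unique : ∀ n → Unique (catalanWords n)
catalanWords-unique n = Unique.filter⁺ isCatalan? (wordsBelow-unique n n)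

------------------------------------------------------------------------
-- The polynomial ring ℤ[y]

-- Coefficients are listed from degree 0 upwards; trailing zeros are allowed,
-- so equality of polynomials is _≈ₚ_ rather than _≡_.
Poly : Set
Poly = List ℤ

coeff : Poly → ℕ → ℤ
coeff []      _       = 0ℤ
coeff (a ∷ _) zero    = a
coeff (_ ∷ p) (suc k) = coeff p k

infix  4 _≈ₚ_
infixl 6 _+ₚ_
infixl 7 _*ₚ_

_≈ₚ_ : Rel Poly 0ℓ
p ≈ₚ q = ∀ k → coeff p k ≡ coeff q k

_+ₚ_ : Poly → Poly → Poly
[]      +ₚ q       = q
(a ∷ p) +ₚ []      = a ∷ p
(a ∷ p) +ₚ (b ∷ q) = a ℤ.+ b ∷ p +ₚ q

-ₚ_ : Poly → Poly
-ₚ_ = map (λ a → ℤ.- a)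

_*ₚ_ : Poly → Poly → Poly
[]      *ₚ q = []
(a ∷ p) *ₚ q = map (a ℤ.*_) q +ₚ (0ℤ ∷ p *ₚ q)

0ₚ 1ₚ : Poly
0ₚ = []
1ₚ = [ 1ℤ ]

y^ₚ_ : ℕ → Poly
y^ₚ k = replicate k 0ℤ ++ 1ₚ

sumₚ : List Poly → Poly
sumₚ = foldr _+ₚ_ 0ₚ

------------------------------------------------------------------------
-- The power series ring ℤ[y][[x]]

-- f n is the coefficient of xⁿ.
Series : Set
Series = ℕ → Poly

infix  4 _≈ˢ_
infixl 6 _+ˢ_ _-ˢ_
infixl 7 _*ˢ_
infixr 8 _·_
infixr 9 _^ˢ_

_≈ˢ_ : Rel Series 0ℓ
f ≈ˢ g = ∀ n → f n ≈ₚ g n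

_+ˢ_ _-ˢ_ _*ˢ_ : Series → Series → Series
(f +ˢ g) n = f n +ₚ g n
(f -ˢ g) n = f n +ₚ (-ₚ g n)
(f *ˢ g) n = sumₚ (map (λ k → f k *ₚ g (n ∸ k)) (upTo (suc n)))

_·_ : ℕ → Series → Series
(m · f) n = map (ℤ.+ m ℤ.*_) (f n)

constant : Poly → Series
constant p zero    = p
constant p (suc _) = 0ₚ

1ˢ x y : Series
1ˢ = constant 1ₚ
y  = constant (y^ₚ 1)
x zero          = 0ₚ
x (suc zero)    = 1ₚ
x (suc (suc _)) = 0ₚ

_^ˢ_ : Series → ℕ → Series
f ^ˢ zero  = 1ˢ
f ^ˢ suc k = f *ˢ f ^ˢ k

-- s is a square root of f with constant term (in x) equal to 1.
IsSqrt : Series → Series → Set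
IsSqrt f s = s 0 ≈ₚ 1ₚ × s *ˢ s ≈ˢ f

------------------------------------------------------------------------
-- The generating function C_(X,Y)(x,y)

C : {X Y : Rel ℕ 0ℓ} → Decidable X → Decidable Y → Series
C X? Y? n = sumₚ (map (λ w → y^ₚ des w) (filter (avoids? X? Y?) (catalanWords n)))

{-# OPTIONS --safe #-}

-- A nonempty Catalan word is 0 (u + 1) v with u, v Catalan words (v starts at
-- the second 0). It avoids (<,>) iff u and v do and, when both are nonempty,
-- u is neither of length 1 nor ends with an ascent; in that case the descent
-- into v adds 1 to des u + des v. The excluded words u are exactly those
-- obtained from an avoiding word by appending its last letter plus 1 (or by
-- appending 0 to the empty word), which changes no descent. Hence
--   C = 1 + x (C + (C - 1) + y (C - 1 - x C) (C - 1)),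
-- a quadratic A C² - B C + D = 0 with A = x y (1 - x), B = 1 - 2x + 2xy - x²y
-- and D = 1 - x + x y, so (B - 2 A C)² = B² - 4 A D = Δ. The square root of Δ
-- with constant term 1 is unique because the sum of two such roots has
-- constant term 2, which is not a zero divisor in ℤ[y].
module Submission where

open import Defs
open import Algebra.Bundles using (CommutativeRing; RawRing)
import Algebra.Morphism.RingMonomorphism as RingMonomorphism
open import Algebra.Morphism.Structures using (IsRingMonomorphism)
open import Algebra.Solver.Ring.AlmostCommutativeRing
  using (fromCommutativeRing; _-Raw-AlmostCommutative⟶_)
open import Data.Bool.Base using (if_then_else_)
open import Data.Empty using (⊥-elim)
open import Data.Integer.Base as ℤ using (ℤ; 0ℤ; 1ℤ)
import Data.Integer.Properties as ℤ
open import Data.List.Base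
  using (List; []; _∷_; _++_; map; foldr; length; filter; applyUpTo; upTo;
         concatMap; cartesianProduct)
open import Data.List.Membership.Propositional using (_∈_)
open import Data.List.Membership.Propositional.Properties
  using (∈-filter⁺; ∈-filter⁻; ∈-upTo⁺; ∈-upTo⁻; ∈-map⁺; ∈-map⁻; ∈-++⁺ˡ; ∈-++⁺ʳ; ∈-++⁻;
         ∈-concat⁺′; ∈-concat⁻′; ∈-cartesianProduct⁺; ∈-cartesianProduct⁻)
open import Data.List.Membership.Propositional.Properties.WithK using (unique∧set⇒bag)
open import Data.List.Properties
  using (++-identityʳ; length-++; length-map; map-++; map-∘; map-upTo; ∷-injective; ∷-injectiveʳ)
open import Data.List.Relation.Binary.BagAndSetEquality using (∼bag⇒↭)
open import Data.List.Relation.Binary.Disjoint.Propositional using (Disjoint)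
open import Data.List.Relation.Binary.Permutation.Propositional using (_↭_)
import Data.List.Relation.Binary.Permutation.Propositional as ↭
open import Data.List.Relation.Binary.Permutation.Propositional.Properties using ()
  renaming (map⁺ to ↭-map⁺)
import Data.List.Relation.Unary.All as All
import Data.List.Relation.Unary.All.Properties as All
import Data.List.Relation.Unary.AllPairs as AllPairs
import Data.List.Relation.Unary.AllPairs.Properties as AllPairs
open import Data.List.Relation.Unary.Any using (here; there)
open import Data.List.Relation.Unary.Linked as Linked using (Linked; [-]; _∷_)
import Data.List.Relation.Unary.Linked.Properties as Linked
open import Data.List.Relation.Unary.Unique.Propositional using (Unique; []; _∷_)
import Data.List.Relation.Unary.Unique.Propositional.Properties as Unique
open import Data.Maybe.Base as Maybe using ()
open import Data.Nat.Base as ℕ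
  using (ℕ; zero; suc; _∸_; _≤_; _<_; _>_; _<ᵇ_; z≤n; s≤s; s≤s⁻¹)
open import Data.Nat.Properties
  using (_<?_; _>?_; _≟_; ≤-refl; ≤-antisym; <-asym; n<1+n; m≤m+n; m+n∸m≡n; m+[n∸m]≡n;
         suc-injective)
open import Data.Product using (∃; ∃₂; ∃!; _×_; _,_; proj₁; proj₂; uncurry)
open import Data.Sum using (_⊎_; inj₁; inj₂)
open import Function.Base using (_∘_; id)
open import Function.Bundles using (mk⇔)
open import Level using (0ℓ)
open import Relation.Binary.PropositionalEquality as ≡ using (_≡_; _≢_; cong; cong₂)
import Relation.Binary.Reasoning.Setoid as ≈-Reasoning
open import Relation.Nullary using (¬_; Dec; yes; no; ¬?)
open import Relation.Nullary.Decidable using (dec⇒maybe; map′)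
open import Relation.Unary using (Pred; Decidable)

-- Formal power series over a commutative ring.

module PowerSeries {c ℓ} (R : CommutativeRing c ℓ) where

  open CommutativeRing R
  open import Algebra.Properties.CommutativeSemigroup +-commutativeSemigroup
    using (interchange)

  infix  4 _≋_
  infixl 7 _⊛_

  _≋_ : (ℕ → Carrier) → (ℕ → Carrier) → Set ℓ
  f ≋ g = ∀ n → f n ≈ g n

  -- The Cauchy product, written as a recursion that peels off the leading coefficient of `f`
  -- instead of as an indexed sum, so that the ring laws follow by induction on the degree. `*ˢ≈⊛`
  -- later connects it with the summation form.
  _⊛_ : (ℕ → Carrier) → (ℕ → Carrier) → ℕ → Carrier
  (f ⊛ g) zero    = f 0 * g 0
  (f ⊛ g) (suc n) = f 0 * g (suc n) + (f ∘ suc ⊛ g) n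

  const : Carrier → ℕ → Carrier
  const a zero    = a
  const a (suc _) = 0#

  ⊛-cong : ∀ {f f′ g g′} → f ≋ f′ → g ≋ g′ → f ⊛ g ≋ f′ ⊛ g′
  ⊛-cong p q zero    = *-cong (p 0) (q 0)
  ⊛-cong p q (suc n) = +-cong (*-cong (p 0) (q (suc n))) (⊛-cong (p ∘ suc) q n)

  -- The mirror image of the defining recursion, peeling `g` instead of `f`. Commutativity needs it
  -- because the definition treats its two factors asymmetrically.
  ⊛-suc : ∀ f g n → (f ⊛ g) (suc n) ≈ (f ⊛ g ∘ suc) n + f (suc n) * g 0
  ⊛-suc f g zero    = refl
  ⊛-suc f g (suc n) =
    trans (+-congˡ (⊛-suc (f ∘ suc) g n)) (sym (+-assoc _ _ _))

  ⊛-comm : ∀ f g → f ⊛ g ≋ g ⊛ f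
  ⊛-comm f g zero    = *-comm _ _
  ⊛-comm f g (suc n) = begin
    f 0 * g (suc n) + (f ∘ suc ⊛ g) n ≈⟨ +-cong (*-comm _ _) (⊛-comm (f ∘ suc) g n) ⟩
    g (suc n) * f 0 + (g ⊛ f ∘ suc) n ≈⟨ +-comm _ _ ⟩
    (g ⊛ f ∘ suc) n + g (suc n) * f 0 ≈⟨ ⊛-suc g f n ⟨
    (g ⊛ f) (suc n)                   ∎
    where open ≈-Reasoning setoid

  ⊛-distribʳ-+ : ∀ h f g → (λ n → f n + g n) ⊛ h ≋ (λ n → (f ⊛ h) n + (g ⊛ h) n)
  ⊛-distribʳ-+ h f g zero    = distribʳ _ _ _
  ⊛-distribʳ-+ h f g (suc n) =
    trans (+-cong (distribʳ _ _ _) (⊛-distribʳ-+ h (f ∘ suc) (g ∘ suc) n))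
          (interchange _ _ _ _)

  ⊛-scaleˡ : ∀ a f g → (λ n → a * f n) ⊛ g ≋ (λ n → a * (f ⊛ g) n)
  ⊛-scaleˡ a f g zero    = *-assoc _ _ _
  ⊛-scaleˡ a f g (suc n) =
    trans (+-cong (*-assoc _ _ _) (⊛-scaleˡ a (f ∘ suc) g n)) (sym (distribˡ _ _ _))

  ⊛-zeroˡ : ∀ {f} g → f ≋ (λ _ → 0#) → f ⊛ g ≋ (λ _ → 0#)
  ⊛-zeroˡ g z zero    = trans (*-congʳ (z 0)) (zeroˡ _)
  ⊛-zeroˡ g z (suc n) =
    trans (+-cong (trans (*-congʳ (z 0)) (zeroˡ _)) (⊛-zeroˡ g (z ∘ suc) n))
          (+-identityˡ _)

  const-⊛ : ∀ a g → const a ⊛ g ≋ (λ n → a * g n)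
  const-⊛ a g zero    = refl
  const-⊛ a g (suc n) = trans (+-congˡ (⊛-zeroˡ g (λ _ → refl) n)) (+-identityʳ _)

  ⊛-assoc : ∀ f g h → (f ⊛ g) ⊛ h ≋ f ⊛ (g ⊛ h)
  ⊛-assoc f g h zero    = *-assoc _ _ _
  ⊛-assoc f g h (suc n) = begin
    f 0 * g 0 * h (suc n) + ((λ k → f 0 * g (suc k) + (f ∘ suc ⊛ g) k) ⊛ h) n
      ≈⟨ +-cong (*-assoc _ _ _) (⊛-distribʳ-+ h (λ k → f 0 * g (suc k)) (f ∘ suc ⊛ g) n) ⟩
    f 0 * (g 0 * h (suc n)) + (((λ k → f 0 * g (suc k)) ⊛ h) n + (f ∘ suc ⊛ g ⊛ h) n)
      ≈⟨ +-congˡ (+-cong (⊛-scaleˡ (f 0) (g ∘ suc) h n) (⊛-assoc (f ∘ suc) g h n)) ⟩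
    f 0 * (g 0 * h (suc n)) + (f 0 * (g ∘ suc ⊛ h) n + (f ∘ suc ⊛ (g ⊛ h)) n)
      ≈⟨ +-assoc _ _ _ ⟨
    f 0 * (g 0 * h (suc n)) + f 0 * (g ∘ suc ⊛ h) n + (f ∘ suc ⊛ (g ⊛ h)) n
      ≈⟨ +-congʳ (distribˡ _ _ _) ⟨
    f 0 * (g ⊛ h) (suc n) + (f ∘ suc ⊛ (g ⊛ h)) n ∎
    where open ≈-Reasoning setoid

  ⊛-identityˡ : ∀ g → const 1# ⊛ g ≋ g
  ⊛-identityˡ g n = trans (const-⊛ 1# g n) (*-identityˡ _)

  commutativeRing : CommutativeRing c ℓ
  commutativeRing = record
    { Carrier = ℕ → Carrier
    ; _≈_     = _≋_
    ; _+_     = λ f g n → f n + g n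
    ; _*_     = _⊛_
    ; -_      = λ f n → - f n
    ; 0#      = λ _ → 0#
    ; 1#      = const 1#
    ; isCommutativeRing = record
      { isRing = record
        { +-isAbelianGroup = record
          { isGroup = record
            { isMonoid = record
              { isSemigroup = record
                { isMagma = record
                  { isEquivalence = record
                    { refl  = λ _ → refl
                    ; sym   = λ p n → sym (p n)
                    ; trans = λ p q n → trans (p n) (q n)
                    }
                  ; ∙-cong = λ p q n → +-cong (p n) (q n)
                  }
                ; assoc = λ _ _ _ _ → +-assoc _ _ _
                }
              ; identity = (λ _ _ → +-identityˡ _) , (λ _ _ → +-identityʳ _)
              }
            ; inverse = (λ _ _ → -‿inverseˡ _) , (λ _ _ → -‿inverseʳ _)
            ; ⁻¹-cong = λ p n → -‿cong (p n)
            }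
          ; comm = λ _ _ _ → +-comm _ _
          }
        ; *-cong     = ⊛-cong
        ; *-assoc    = ⊛-assoc
        ; *-identity = ⊛-identityˡ
                     , λ f n → trans (⊛-comm f (const 1#) n) (⊛-identityˡ f n)
        ; distrib    = (λ f g h n → trans (⊛-comm f _ n)
                         (trans (⊛-distribʳ-+ f g h n) (+-cong (⊛-comm g f n) (⊛-comm h f n))))
                     , ⊛-distribʳ-+
        }
      ; *-comm = ⊛-comm
      }
    }

  -- The constant term of the product forces `f 0` to vanish. The shifted series `f ∘ suc` then
  -- satisfies the same hypothesis, so every coefficient is reached by induction.
  cancelʳ-nonZeroDivisor : ∀ f g → (∀ a → a * g 0 ≈ 0# → a ≈ 0#) →
                           f ⊛ g ≋ (λ _ → 0#) → f ≋ (λ _ → 0#)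
  cancelʳ-nonZeroDivisor f g reg p zero    = reg (f 0) (p 0)
  cancelʳ-nonZeroDivisor f g reg p (suc n) =
    cancelʳ-nonZeroDivisor (f ∘ suc) g reg tail-⊛ n
    where
    tail-⊛ : f ∘ suc ⊛ g ≋ (λ _ → 0#)
    tail-⊛ k = begin
      (f ∘ suc ⊛ g) k                   ≈⟨ +-identityˡ _ ⟨
      0# + (f ∘ suc ⊛ g) k              ≈⟨ +-congʳ (zeroˡ _) ⟨
      0# * g (suc k) + (f ∘ suc ⊛ g) k  ≈⟨ +-congʳ (*-congʳ (reg (f 0) (p 0))) ⟨
      (f ⊛ g) (suc k)                   ≈⟨ p (suc k) ⟩
      0#                                ∎
      where open ≈-Reasoning setoid

-- The rings ℤ[y] and ℤ[y][[x]]

module ℤ[[y]] = PowerSeries ℤ.+-*-commutativeRing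

rawPolyRing : RawRing 0ℓ 0ℓ
rawPolyRing = record
  { _≈_ = _≈ₚ_ ; _+_ = _+ₚ_ ; _*_ = _*ₚ_ ; -_ = -ₚ_ ; 0# = 0ₚ ; 1# = 1ₚ }

coeff-+ₚ : ∀ p q k → coeff (p +ₚ q) k ≡ coeff p k ℤ.+ coeff q k
coeff-+ₚ []      q       k       = ≡.sym (ℤ.+-identityˡ _)
coeff-+ₚ (a ∷ p) []      k       = ≡.sym (ℤ.+-identityʳ _)
coeff-+ₚ (a ∷ p) (b ∷ q) zero    = ≡.refl
coeff-+ₚ (a ∷ p) (b ∷ q) (suc k) = coeff-+ₚ p q k

coeff-map : ∀ (f : ℤ → ℤ) → f 0ℤ ≡ 0ℤ → ∀ p k → coeff (map f p) k ≡ f (coeff p k)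
coeff-map f f0 []      k       = ≡.sym f0
coeff-map f f0 (a ∷ p) zero    = ≡.refl
coeff-map f f0 (a ∷ p) (suc k) = coeff-map f f0 p k

coeff-*ₚ : ∀ p q k → coeff (p *ₚ q) k ≡ (coeff p ℤ[[y]].⊛ coeff q) k
coeff-*ₚ []      q k = ≡.sym (ℤ[[y]].⊛-zeroˡ (coeff q) (λ _ → ≡.refl) k)
coeff-*ₚ (a ∷ p) q k =
  ≡.trans (coeff-+ₚ (map (a ℤ.*_) q) (0ℤ ∷ p *ₚ q) k)
    (≡.trans (cong (ℤ._+ _) (coeff-map (a ℤ.*_) (ℤ.*-zeroʳ a) q k)) (shift k))
  where
  shift : ∀ k → a ℤ.* coeff q k ℤ.+ coeff (0ℤ ∷ p *ₚ q) k ≡ (coeff (a ∷ p) ℤ[[y]].⊛ coeff q) k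
  shift zero    = ℤ.+-identityʳ _
  shift (suc k) = cong (ℤ._+_ (a ℤ.* coeff q (suc k))) (coeff-*ₚ p q k)

-- Polynomials embed in ℤ[[y]] through their coefficient functions. Since `_≈ₚ_` is equality of
-- those functions, injectivity is the identity, and the ring axioms for `Poly` are pulled back
-- rather than proved on lists.
coeff-isRingMonomorphism : IsRingMonomorphism rawPolyRing
  (CommutativeRing.rawRing ℤ[[y]].commutativeRing) coeff
coeff-isRingMonomorphism = record
  { isRingHomomorphism = record
    { isSemiringHomomorphism = record
      { isNearSemiringHomomorphism = record
        { +-isMonoidHomomorphism = record
          { isMagmaHomomorphism = record
            { isRelHomomorphism = record { cong = id }
            ; homo = coeff-+ₚ
            }
          ; ε-homo = λ _ → ≡.refl
          }
        ; *-homo = coeff-*ₚ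
        }
      ; 1#-homo = λ { zero → ≡.refl ; (suc _) → ≡.refl }
      }
    ; -‿homo = coeff-map ℤ.-_ ≡.refl
    }
  ; injective = id
  }

polyRing : CommutativeRing 0ℓ 0ℓ
polyRing = record
  { isCommutativeRing = RingMonomorphism.isCommutativeRing coeff-isRingMonomorphism
      (CommutativeRing.isCommutativeRing ℤ[[y]].commutativeRing) }

module P = CommutativeRing polyRing
module P[[x]] = PowerSeries polyRing

rawSeriesRing : RawRing 0ℓ 0ℓ
rawSeriesRing = record
  { _≈_ = _≈ˢ_ ; _+_ = _+ˢ_ ; _*_ = _*ˢ_
  ; -_ = λ f n → -ₚ f n ; 0# = λ _ → 0ₚ ; 1# = 1ˢ }

*ˢ≈⊛ : ∀ f g → f *ˢ g ≈ˢ f P[[x]].⊛ g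
*ˢ≈⊛ f g n k =
  ≡.trans (cong (λ ps → coeff (sumₚ ps) k) (map-upTo (λ i → f i *ₚ g (n ∸ i)) (suc n)))
          (sum-applyUpTo f n k)
  where
  -- Quantified afresh over `f`: removing the first summand shifts `f` to `f ∘ suc`, while `g` stays
  -- fixed because `suc n ∸ suc i` reduces to `n ∸ i`.
  sum-applyUpTo : ∀ f n → sumₚ (applyUpTo (λ i → f i *ₚ g (n ∸ i)) (suc n)) ≈ₚ (f P[[x]].⊛ g) n
  sum-applyUpTo f zero    = P.+-identityʳ (f 0 *ₚ g 0)
  sum-applyUpTo f (suc n) = P.+-congˡ {x = f 0 *ₚ g (suc n)} (sum-applyUpTo (f ∘ suc) n)

constant≈const : ∀ p → constant p ≈ˢ P[[x]].const p
constant≈const p zero    _ = ≡.refl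
constant≈const p (suc _) _ = ≡.refl

-- The identity map carries the ring axioms from `⊛` over to the summation product `*ˢ`.
id-isRingMonomorphism : IsRingMonomorphism rawSeriesRing
  (CommutativeRing.rawRing P[[x]].commutativeRing) id
id-isRingMonomorphism = record
  { isRingHomomorphism = record
    { isSemiringHomomorphism = record
      { isNearSemiringHomomorphism = record
        { +-isMonoidHomomorphism = record
          { isMagmaHomomorphism = record
            { isRelHomomorphism = record { cong = id }
            ; homo = λ _ _ _ _ → ≡.refl
            }
          ; ε-homo = λ _ _ → ≡.refl
          }
        ; *-homo = *ˢ≈⊛
        }
      ; 1#-homo = constant≈const 1ₚ
      }
    ; -‿homo = λ _ _ _ → ≡.refl
    }
  ; injective = id
  }

seriesRing : CommutativeRing 0ℓ 0ℓ
seriesRing = record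
  { isCommutativeRing = RingMonomorphism.isCommutativeRing id-isRingMonomorphism
      (CommutativeRing.isCommutativeRing P[[x]].commutativeRing) }

module S = CommutativeRing seriesRing

-- Square roots of power series

integer : ℤ → Series
integer a = constant (a ∷ [])

-- Gives the ring solver a coefficient ring with decidable equality, namely ℤ embedded as constant
-- series.
ℤ⟶seriesRing : CommutativeRing.rawRing ℤ.+-*-commutativeRing
                 -Raw-AlmostCommutative⟶ fromCommutativeRing seriesRing
ℤ⟶seriesRing = record
  { ⟦_⟧    = integer
  ; +-homo = λ { a b zero _ → ≡.refl ; a b (suc _) _ → ≡.refl }
  ; *-homo = λ a b n k → ≡.sym (≡.trans (*ˢ≈⊛ (integer a) (integer b) n k) (integer-⊛ a b n k))
  ; -‿homo = λ { a zero _ → ≡.refl ; a (suc _) _ → ≡.refl }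
  ; 0-homo = λ { zero zero → ≡.refl ; zero (suc _) → ≡.refl ; (suc _) _ → ≡.refl }
  ; 1-homo = λ { zero _ → ≡.refl ; (suc _) _ → ≡.refl }
  }
  where
  integer-⊛ : ∀ a b → integer a P[[x]].⊛ integer b ≈ˢ integer (a ℤ.* b)
  integer-⊛ a b zero    zero    = ℤ.+-identityʳ (a ℤ.* b)
  integer-⊛ a b zero    (suc _) = ≡.refl
  integer-⊛ a b (suc n) k       =
    P.+-cong {x = (a ∷ []) *ₚ 0ₚ} {y = 0ₚ} {u = ((λ _ → 0ₚ) P[[x]].⊛ integer b) n} {v = 0ₚ}
      (P.zeroʳ (a ∷ []))
      (P[[x]].⊛-zeroˡ {f = λ _ → 0ₚ} (integer b) (λ _ _ → ≡.refl) n) k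

·≈integer-* : ∀ m f → m · f ≈ˢ integer (ℤ.+ m) *ˢ f
·≈integer-* m f n k = ≡.sym (begin
  coeff ((integer (ℤ.+ m) *ˢ f) n) k               ≡⟨ *ˢ≈⊛ (integer (ℤ.+ m)) f n k ⟩
  coeff ((integer (ℤ.+ m) P[[x]].⊛ f) n) k
    ≡⟨ P[[x]].⊛-cong {g = f} (constant≈const (ℤ.+ m ∷ [])) (λ _ _ → ≡.refl) n k ⟩
  coeff ((P[[x]].const (ℤ.+ m ∷ []) P[[x]].⊛ f) n) k ≡⟨ P[[x]].const-⊛ (ℤ.+ m ∷ []) f n k ⟩
  coeff (map (ℤ.+ m ℤ.*_) (f n) +ₚ (0ℤ ∷ [])) k    ≡⟨ coeff-+ₚ (map (ℤ.+ m ℤ.*_) (f n)) (0ℤ ∷ []) k ⟩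
  coeff ((m · f) n) k ℤ.+ coeff (0ℤ ∷ []) k        ≡⟨ cong (ℤ._+_ (coeff ((m · f) n) k)) (coeff-0∷[] k) ⟩
  coeff ((m · f) n) k ℤ.+ 0ℤ                       ≡⟨ ℤ.+-identityʳ _ ⟩
  coeff ((m · f) n) k                              ∎)
  where
  open ≡.≡-Reasoning
  coeff-0∷[] : ∀ k → coeff (0ℤ ∷ []) k ≡ 0ℤ
  coeff-0∷[] zero    = ≡.refl
  coeff-0∷[] (suc _) = ≡.refl

-- Polynomial identities in a commutative ring with integer constants.

module ℤ-Algebra {c ℓ} (R : CommutativeRing c ℓ)
  (φ : CommutativeRing.rawRing ℤ.+-*-commutativeRing
         -Raw-AlmostCommutative⟶ fromCommutativeRing R) where

  open CommutativeRing R
  open _-Raw-AlmostCommutative⟶_ φ using (⟦_⟧)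
  open import Algebra.Solver.Ring (CommutativeRing.rawRing ℤ.+-*-commutativeRing)
    (fromCommutativeRing R) φ
    (λ a b → Maybe.map (λ a≡b → reflexive (cong ⟦_⟧ a≡b)) (dec⇒maybe (a ℤ.≟ b)))
    using (Polynomial; solve; con; _:+_; _:*_; _:-_; _:=_)

  difference-of-squares : ∀ s t → s * s ≈ t * t → (s - t) * (s + t) ≈ 0#
  difference-of-squares s t s²≈t² = begin
    (s - t) * (s + t) ≈⟨ solve 2 (λ s t → (s :- t) :* (s :+ t) := s :* s :- t :* t) refl s t ⟩
    s * s - t * t     ≈⟨ +-congʳ s²≈t² ⟩
    t * t - t * t     ≈⟨ -‿inverseʳ _ ⟩
    0#                ∎
    where open ≈-Reasoning setoid

  subtraction-swap : ∀ a b s → b - a ≈ s → a ≈ b - s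
  subtraction-swap a b s b-a≈s =
    trans (solve 2 (λ a b → a := b :- (b :- a)) refl a b) (+-congˡ (-‿cong b-a≈s))

  module _ (_×_ : ℕ → Carrier → Carrier) (×≈* : ∀ m a → m × a ≈ ⟦ ℤ.+ m ⟧ * a) (x y : Carrier) where

    -- Powers are spelled out as `x * (x * 1#)`, and the scalar action `_×_` is kept apart from
    -- multiplication, so that instantiating at series yields the expressions of the theorem
    -- definitionally.
    2A B Δ : Carrier
    2A = (2 × x) * y * (1# - x)
    B  = 1# - (2 × x) + (2 × x) * y - x * (x * 1#) * y
    Δ  = 1# - (4 × x) + (4 × (x * (x * 1#))) - (2 × (x * (x * 1#))) * y
           + x * (x * (x * (x * 1#))) * (y * (y * 1#))

    -- With e the right-hand side, c ≈ e reads A c² - B c + D ≈ 0 where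
    -- D = 1 - x + x y, and Δ = B² - 4 A D.
    complete-square : ∀ c →
      c ≈ 1# + x * (c + (c - 1#) + y * ((c - 1# - x * c) * (c - 1#))) →
      (B - 2A * c) * (B - 2A * c) ≈ Δ
    complete-square c c≈e = begin
      (B - 2A * c) * (B - 2A * c)  ≈⟨ *-cong B-2Ac B-2Ac ⟩
      (B′ - 2A′ * c) * (B′ - 2A′ * c)
        -- The left side exceeds the discriminant by 4 A (A c² - B c + D), which is twice `2A′`
        -- times `e - c`.
        ≈⟨ solve 3 (λ x y c →
             let b = one :- two :* x :+ two :* x :* y :- x :* (x :* one) :* y
                 a = two :* x :* y :* (one :- x)
             in (b :- a :* c) :* (b :- a :* c) :=
                one :- four :* x :+ four :* (x :* (x :* one)) :- two :* (x :* (x :* one)) :* y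
                  :+ x :* (x :* (x :* (x :* one))) :* (y :* (y :* one))
                  :+ two :* a :*
                     (one :+ x :* (c :+ (c :- one) :+ y :* ((c :- one :- x :* c) :* (c :- one)))
                       :- c))
             refl x y c ⟩
      Δ′ + ⟦ ℤ.+ 2 ⟧ * 2A′ * (e - c)  ≈⟨ +-congˡ (*-congˡ (+-congʳ c≈e′)) ⟩
      Δ′ + ⟦ ℤ.+ 2 ⟧ * 2A′ * (c - c)  ≈⟨ +-congˡ (*-congˡ (-‿inverseʳ c)) ⟩
      Δ′ + ⟦ ℤ.+ 2 ⟧ * 2A′ * 0#       ≈⟨ +-congˡ (zeroʳ _) ⟩
      Δ′ + 0#                         ≈⟨ +-identityʳ _ ⟩
      Δ′                              ≈⟨ Δ≈Δ′ ⟨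
      Δ                               ∎
      where
      open ≈-Reasoning setoid
      open _-Raw-AlmostCommutative⟶_ φ using (1-homo)
      one two four : ∀ {n} → Polynomial n
      one  = con 1ℤ
      two  = con (ℤ.+ 2)
      four = con (ℤ.+ 4)
      -- The solver reads its constant 1 as `⟦ 1ℤ ⟧`, which agrees with `1#` only up to `≈`. The
      -- primed expressions are the originals in the solver's form.
      i = ⟦ 1ℤ ⟧
      e 2A′ B′ Δ′ : Carrier
      e   = i + x * (c + (c - i) + y * ((c - i - x * c) * (c - i)))
      2A′ = ⟦ ℤ.+ 2 ⟧ * x * y * (i - x)
      B′  = i - ⟦ ℤ.+ 2 ⟧ * x + ⟦ ℤ.+ 2 ⟧ * x * y - x * (x * i) * y
      Δ′  = i - ⟦ ℤ.+ 4 ⟧ * x + ⟦ ℤ.+ 4 ⟧ * (x * (x * i))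
              - ⟦ ℤ.+ 2 ⟧ * (x * (x * i)) * y + x * (x * (x * (x * i))) * (y * (y * i))
      1≈i : 1# ≈ i
      1≈i = sym 1-homo
      x²≈ : x * (x * 1#) ≈ x * (x * i)
      x²≈ = *-congˡ (*-congˡ 1≈i)
      B-2Ac : B - 2A * c ≈ B′ - 2A′ * c
      B-2Ac = +-cong
        (+-cong (+-cong (+-cong 1≈i (-‿cong (×≈* 2 x))) (*-congʳ (×≈* 2 x)))
                (-‿cong (*-congʳ x²≈)))
        (-‿cong (*-congʳ (*-cong (*-congʳ (×≈* 2 x)) (+-congʳ 1≈i))))
      Δ≈Δ′ : Δ ≈ Δ′
      Δ≈Δ′ = +-cong
        (+-cong (+-cong (+-cong 1≈i (-‿cong (×≈* 4 x))) (trans (×≈* 4 _) (*-congˡ x²≈)))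
                (-‿cong (*-congʳ (trans (×≈* 2 _) (*-congˡ x²≈)))))
        (*-cong (*-congˡ (*-congˡ x²≈)) (*-congˡ (*-congˡ 1≈i)))
      c-1≈c-i : c - 1# ≈ c - i
      c-1≈c-i = +-congˡ (-‿cong 1≈i)
      c≈e′ : e ≈ c
      c≈e′ = sym (trans c≈e (+-cong 1≈i (*-congˡ (+-cong (+-congˡ c-1≈c-i)
        (*-congˡ (*-cong (+-congʳ c-1≈c-i) c-1≈c-i))))))

module ℤ-Series = ℤ-Algebra seriesRing ℤ⟶seriesRing

-- For positive or negative `z` the sum reduces to a nonzero constructor form, so the hypothesis is
-- empty and only the zero clause remains.
z+z≡0⇒z≡0 : ∀ z → z ℤ.+ z ≡ 0ℤ → z ≡ 0ℤ
z+z≡0⇒z≡0 (ℤ.+ zero) _ = ≡.refl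

-- Here `q` and `r` stand for the constant terms of two square roots, so this is the regularity
-- condition needed to cancel the sum of the roots.
p*2≈0⇒p≈0 : ∀ p q r → q ≈ₚ 1ₚ → r ≈ₚ 1ₚ → p *ₚ (q +ₚ r) ≈ₚ 0ₚ → p ≈ₚ 0ₚ
p*2≈0⇒p≈0 p q r q≈1 r≈1 eq k = z+z≡0⇒z≡0 (coeff p k) (begin
  coeff p k ℤ.+ coeff p k                     ≡⟨ cong₂ ℤ._+_ (p*1≈p q q≈1) (p*1≈p r r≈1) ⟨
  coeff (p *ₚ q) k ℤ.+ coeff (p *ₚ r) k       ≡⟨ coeff-+ₚ (p *ₚ q) (p *ₚ r) k ⟨
  coeff (p *ₚ q +ₚ p *ₚ r) k                  ≡⟨ P.distribˡ p q r k ⟨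
  coeff (p *ₚ (q +ₚ r)) k                     ≡⟨ eq k ⟩
  0ℤ                                          ∎)
  where
  open ≡.≡-Reasoning
  p*1≈p : ∀ q → q ≈ₚ 1ₚ → coeff (p *ₚ q) k ≡ coeff p k
  p*1≈p q q≈1 = ≡.trans (P.*-cong {x = p} {y = p} {u = q} {v = 1ₚ} (λ _ → ≡.refl) q≈1 k) (P.*-identityʳ p k)

-- The product of `s -ˢ t` and `s +ˢ t` is zero. Rewritten with `⊛`, it allows the factor `s +ˢ t`
-- to be cancelled.
sqrt-unique : ∀ f s t → IsSqrt f s → IsSqrt f t → s ≈ˢ t
sqrt-unique f s t (s₀ , s²≈f) (t₀ , t²≈f) =
  x-y≈0⇒x≈y s t
    (P[[x]].cancelʳ-nonZeroDivisor (s -ˢ t) (s +ˢ t) (λ p → p*2≈0⇒p≈0 p (s 0) (t 0) s₀ t₀)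
      (λ n k → ≡.trans (≡.sym (*ˢ≈⊛ (s -ˢ t) (s +ˢ t) n k))
        (ℤ-Series.difference-of-squares s t (λ n k → ≡.trans (s²≈f n k) (≡.sym (t²≈f n k))) n k)))
  where open import Algebra.Properties.Group S.+-group using () renaming (x∙y⁻¹≈ε⇒x≈y to x-y≈0⇒x≈y)

-- Peaks in Catalan words

module Words where

  open ≡ using (refl; sym; trans; subst)
  open import Data.Nat.Base using (_+_)
  open import Data.Nat.Properties using (+-assoc; +-suc; 0≢1+n)

  -- First-return decomposition of Catalan words.

  Steps : Word → Set
  Steps = Linked (λ a b → b ≤ suc a)

  -- The first-return decomposition: v starts at the second 0 of the word.
  join : Word → Word → Word
  join u v = 0 ∷ map suc u ++ v

  steps-++ : ∀ p u {v} → Steps (p ∷ map suc u) → IsCatalan v → Steps (p ∷ map suc u ++ v)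
  steps-++ p []      l       empty     = [-]
  steps-++ p []      l       (start m) = z≤n ∷ m
  steps-++ p (a ∷ u) (r ∷ l) c         = r ∷ steps-++ (suc a) u l c

  -- The induction allows any preceding letter `p`. Every letter before the next 0 is a successor
  -- and goes into `map suc u`; the suffix from that 0 on inherits its steps and hence is Catalan.
  first-return : ∀ {p} t → Steps (p ∷ t) →
                 ∃₂ λ u v → t ≡ map suc u ++ v × Steps (p ∷ map suc u) × IsCatalan v
  first-return []          l = [] , [] , refl , [-] , empty
  first-return (zero ∷ t)  l = [] , zero ∷ t , refl , [-] , start (Linked.tail l)
  first-return (suc a ∷ t) (r ∷ l) with first-return t l
  ... | u , v , refl , l′ , c = a ∷ u , v , refl , r ∷ l′ , c

  isCatalan⇒steps-0∷ : ∀ {u} → IsCatalan u → Steps (0 ∷ map suc u)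
  isCatalan⇒steps-0∷ empty     = [-]
  isCatalan⇒steps-0∷ (start l) = s≤s z≤n ∷ Linked.map⁺ (Linked.map s≤s l)

  -- The step out of the leading 0 reaches at most 1, which forces a nonempty `u` to start with 0.
  steps-0∷⇒isCatalan : ∀ {u} → Steps (0 ∷ map suc u) → IsCatalan u
  steps-0∷⇒isCatalan {[]}        l       = empty
  steps-0∷⇒isCatalan {zero ∷ u}  (r ∷ l) = start (Linked.map s≤s⁻¹ (Linked.map⁻ l))
  steps-0∷⇒isCatalan {suc a ∷ u} (s≤s () ∷ l)

  join-isCatalan : ∀ {u v} → IsCatalan u → IsCatalan v → IsCatalan (join u v)
  join-isCatalan {u} cu cv = start (steps-++ 0 u (isCatalan⇒steps-0∷ cu) cv)

  -- A Catalan `v` is empty or starts with 0, a letter that never occurs in `map suc u`, so the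
  -- boundary between the factors can be recovered.
  join-injective : ∀ u u′ {v v′} → IsCatalan v → IsCatalan v′ →
                   map suc u ++ v ≡ map suc u′ ++ v′ → u ≡ u′ × v ≡ v′
  join-injective []      []        c  c′ eq = refl , eq
  join-injective []      (a ∷ u′)  () c′ refl
  join-injective (a ∷ u) []        c  () refl
  join-injective (a ∷ u) (a′ ∷ u′) c  c′ eq with ∷-injective eq
  ... | a≡a′ , eq′ with join-injective u u′ c c′ eq′ | suc-injective a≡a′
  ...   | refl , v≡v′ | refl = refl , v≡v′

  -- Peaks, final ascents and descents.

  HasPeak : Word → Set
  HasPeak = Contains _<_ _>_

  -- Peaked (suc a) w says that a ∷ w ends with a step up by 1, which creates a
  -- peak when a descent follows; w itself is nonempty.
  data Peaked : ℕ → Word → Set where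
    last : ∀ {b} → Peaked b (b ∷ [])
    next : ∀ {a b w} → Peaked (suc a) w → Peaked b (a ∷ w)

  peaked? : ∀ b w → Dec (Peaked b w)
  peaked? b []          = no λ ()
  peaked? b (a ∷ [])    = map′ (λ { refl → last }) (λ { last → refl ; (next ()) }) (a ≟ b)
  peaked? b (a ∷ c ∷ w) = map′ next (λ { (next p) → p }) (peaked? (suc a) (c ∷ w))

  -- Appends the last letter plus 1. The argument `b` carries the successor of the preceding letter;
  -- the initial value 0 makes the empty word rise to `0 ∷ []`.
  rise : ℕ → Word → Word
  rise b []      = b ∷ []
  rise b (a ∷ w) = a ∷ rise (suc a) w

  rise-peaked : ∀ b w → Peaked b (rise b w)
  rise-peaked b []      = last
  rise-peaked b (a ∷ w) = next (rise-peaked (suc a) w)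

  -- With `rise-peaked`, this identifies the image of `rise b` with the words satisfying `Peaked b`,
  -- so the excluded left factors can be counted by deleting their last letter.
  peaked⇒rise : ∀ {b w} → Peaked b w → ∃ λ t → w ≡ rise b t
  peaked⇒rise last             = [] , refl
  peaked⇒rise (next {a = a} p) with peaked⇒rise p
  ... | t , refl = a ∷ t , refl

  rise-injective : ∀ b w w′ → rise b w ≡ rise b w′ → w ≡ w′
  rise-injective b []          []            eq   = refl
  rise-injective b []          (_ ∷ [])      ()
  rise-injective b []          (_ ∷ _ ∷ _)   ()
  rise-injective b (_ ∷ [])    []            ()
  rise-injective b (_ ∷ _ ∷ _) []            ()
  rise-injective b (a ∷ w)     (a′ ∷ w′)     eq with ∷-injective eq
  ... | refl , eq′ = cong (a ∷_) (rise-injective (suc a) w w′ eq′)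

  length-rise : ∀ b w → length (rise b w) ≡ suc (length w)
  length-rise b []      = refl
  length-rise b (a ∷ w) = cong suc (length-rise (suc a) w)

  steps-rise⁺ : ∀ a w → Steps (a ∷ w) → Steps (a ∷ rise (suc a) w)
  steps-rise⁺ a []      l       = ≤-refl ∷ [-]
  steps-rise⁺ a (b ∷ w) (r ∷ l) = r ∷ steps-rise⁺ b w l

  steps-rise⁻ : ∀ a w → Steps (a ∷ rise (suc a) w) → Steps (a ∷ w)
  steps-rise⁻ a []      l       = [-]
  steps-rise⁻ a (b ∷ w) (r ∷ l) = r ∷ steps-rise⁻ b w l

  rise-isCatalan⁺ : ∀ {w} → IsCatalan w → IsCatalan (rise 0 w)
  rise-isCatalan⁺ empty     = start [-]
  rise-isCatalan⁺ (start l) = start (steps-rise⁺ 0 _ l)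

  rise-isCatalan⁻ : ∀ w → IsCatalan (rise 0 w) → IsCatalan w
  rise-isCatalan⁻ []      c         = empty
  rise-isCatalan⁻ (0 ∷ w) (start l) = start (steps-rise⁻ 0 w l)

  hasPeak-rise⁺ : ∀ b {w} → HasPeak w → HasPeak (rise b w)
  hasPeak-rise⁺ b (here p q) = here p q
  hasPeak-rise⁺ b (there h)  = there (hasPeak-rise⁺ _ h)

  -- The only new triple ends with the appended letter, which is larger than its predecessor, so
  -- that triple cannot end in a descent.
  hasPeak-rise⁻ : ∀ b w → HasPeak (rise b w) → HasPeak w
  hasPeak-rise⁻ b []              (there ())
  hasPeak-rise⁻ b (a ∷ [])        (there (there ()))
  hasPeak-rise⁻ b (a ∷ c ∷ [])    (here p q)         = ⊥-elim (<-asym q (n<1+n c))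
  hasPeak-rise⁻ b (a ∷ c ∷ [])    (there (there (there ())))
  hasPeak-rise⁻ b (a ∷ c ∷ d ∷ w) (here p q)         = here p q
  hasPeak-rise⁻ b (a ∷ c ∷ d ∷ w) (there h)          = there (hasPeak-rise⁻ (suc a) (c ∷ d ∷ w) h)

  des-suc : ∀ a → des (a ∷ suc a ∷ []) ≡ 0
  des-suc zero    = refl
  des-suc (suc a) = des-suc a

  des-rise : ∀ b w → des (rise b w) ≡ des w
  des-rise b []          = refl
  des-rise b (a ∷ [])    = des-suc a
  des-rise b (a ∷ c ∷ w) = cong (_ +_) (des-rise (suc a) (c ∷ w))

  hasPeak-map-suc⁺ : ∀ {w} → HasPeak w → HasPeak (map suc w)
  hasPeak-map-suc⁺ (here p q) = here (s≤s p) (s≤s q)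
  hasPeak-map-suc⁺ (there h)  = there (hasPeak-map-suc⁺ h)

  hasPeak-map-suc⁻ : ∀ w → HasPeak (map suc w) → HasPeak w
  hasPeak-map-suc⁻ (a ∷ b ∷ c ∷ w) (here p q) = here (s≤s⁻¹ p) (s≤s⁻¹ q)
  hasPeak-map-suc⁻ (a ∷ w)         (there h)  = there (hasPeak-map-suc⁻ w h)

  hasPeak-++⁺ˡ : ∀ {w} v → HasPeak w → HasPeak (w ++ v)
  hasPeak-++⁺ˡ v (here p q) = here p q
  hasPeak-++⁺ˡ v (there h)  = there (hasPeak-++⁺ˡ v h)

  hasPeak-++⁺ʳ : ∀ w {v} → HasPeak v → HasPeak (w ++ v)
  hasPeak-++⁺ʳ []      h = h
  hasPeak-++⁺ʳ (a ∷ w) h = there (hasPeak-++⁺ʳ w h)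

  -- The only triple involving the leading 0 continues with 1 and then a positive letter, so it does
  -- not end in a descent.
  hasPeak-join⁻ˡ : ∀ {u} → IsCatalan u → HasPeak (0 ∷ map suc u) → HasPeak u
  hasPeak-join⁻ˡ {[]}            _         (there ())
  hasPeak-join⁻ˡ {0 ∷ []}        _         (there (there ()))
  hasPeak-join⁻ˡ {0 ∷ _ ∷ _}     _         (here _ (s≤s ()))
  hasPeak-join⁻ˡ {u@(0 ∷ _ ∷ _)} _         (there h) = hasPeak-map-suc⁻ u h

  hasPeak-0∷⁻ : ∀ {v} → IsCatalan v → HasPeak (0 ∷ v) → HasPeak v
  hasPeak-0∷⁻ (start l) (here () _)
  hasPeak-0∷⁻ _         (there h) = h

  -- Besides peaks inside either factor, two triples straddle the boundary. The one centred at the 0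
  -- cannot begin with an ascent; the one ending at the 0 is a peak only if the left factor ends
  -- with an ascent.
  hasPeak-++-0∷ : ∀ p a u v → Steps (p ∷ map suc (a ∷ u)) →
                  HasPeak (p ∷ map suc (a ∷ u) ++ 0 ∷ v) →
                  HasPeak (p ∷ map suc (a ∷ u)) ⊎ Peaked p (a ∷ u) ⊎ HasPeak (0 ∷ v)
  hasPeak-++-0∷ p a []      v (r ∷ l) (here q _) =
    -- The ascent gives `p ≤ a` and the Catalan step gives `a ≤ p`, so the final ascent is by
    -- exactly 1.
    inj₂ (inj₁ (subst (λ b → Peaked p (b ∷ [])) (≤-antisym (s≤s⁻¹ q) (s≤s⁻¹ r)) last))
  hasPeak-++-0∷ p a []      v l       (there (here () _))
  hasPeak-++-0∷ p a []      v l       (there (there h)) = inj₂ (inj₂ h)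
  hasPeak-++-0∷ p a (b ∷ u) v l       (here q r)        = inj₁ (here q r)
  hasPeak-++-0∷ p a (b ∷ u) v (_ ∷ l) (there h) with hasPeak-++-0∷ (suc a) b u v l h
  ... | inj₁ h′        = inj₁ (there h′)
  ... | inj₂ (inj₁ h′) = inj₂ (inj₁ (next h′))
  ... | inj₂ (inj₂ h′) = inj₂ (inj₂ h′)

  peaked⇒hasPeak : ∀ p u v → Peaked p u → HasPeak (p ∷ map suc u ++ 0 ∷ v)
  peaked⇒hasPeak p (_ ∷ [])    v last     = here ≤-refl (s≤s z≤n)
  peaked⇒hasPeak p (a ∷ u)     v (next h) = there (peaked⇒hasPeak (suc a) u v h)

  des-0∷ : ∀ {v} → IsCatalan v → des (0 ∷ v) ≡ des v
  des-0∷ empty     = refl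
  des-0∷ (start _) = refl

  des-map-suc : ∀ u → des (map suc u) ≡ des u
  des-map-suc []          = refl
  des-map-suc (a ∷ [])    = refl
  des-map-suc (a ∷ b ∷ u) = cong (_ +_) (des-map-suc (b ∷ u))

  des-0∷map-suc : ∀ {u} → IsCatalan u → des (0 ∷ map suc u) ≡ des u
  des-0∷map-suc empty         = refl
  des-0∷map-suc (start {w} l) = des-map-suc (0 ∷ w)

  des-map-suc-++-0∷ : ∀ a u v → des (map suc (a ∷ u) ++ 0 ∷ v) ≡ des (a ∷ u) + suc (des (0 ∷ v))
  des-map-suc-++-0∷ a []      v = refl
  des-map-suc-++-0∷ a (b ∷ u) v =
    trans (cong (_ +_) (des-map-suc-++-0∷ b u v)) (sym (+-assoc (if b <ᵇ a then 1 else 0) (des (b ∷ u)) _))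

  -- The extra descent is at the junction, where the positive last letter of `map suc u` meets the 0
  -- that starts `v`.
  des-join : ∀ {u v} → IsCatalan u → u ≢ [] → IsCatalan v → v ≢ [] →
             des (join u v) ≡ suc (des u + des v)
  des-join empty         u≢[] _             _    = ⊥-elim (u≢[] refl)
  des-join (start _)     _    empty         v≢[] = ⊥-elim (v≢[] refl)
  des-join (start {u} _) _    (start {v} _) _    =
    trans (des-map-suc-++-0∷ 0 u v) (+-suc (des (0 ∷ u)) (des (0 ∷ v)))

  -- Listing the avoiders and decomposing them bijectively.

  avoiders nonempties unpeaked : ℕ → List Word
  avoiders n         = filter (avoids? _<?_ _>?_) (catalanWords n)
  nonempties zero    = []
  nonempties (suc n) = avoiders (suc n)
  -- These are the left factors `u` that may precede a nonempty `v`.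
  unpeaked n         = filter (¬? ∘ peaked? 0) (nonempties n)

  record IsAvoider (n : ℕ) (w : Word) : Set where
    constructor avoider
    field
      isCatalan : IsCatalan w
      avoids    : ¬ HasPeak w
      length≡   : length w ≡ n

  avoiders⁺ : ∀ {n w} → IsAvoider n w → w ∈ avoiders n
  avoiders⁺ (avoider c a refl) = ∈-filter⁺ (avoids? _<?_ _>?_) (catalanWords-complete c) a

  avoiders⁻ : ∀ {n w} → w ∈ avoiders n → IsAvoider n w
  avoiders⁻ {n} w∈ with ∈-filter⁻ (avoids? _<?_ _>?_) {xs = catalanWords n} w∈
  ... | w∈′ , a = avoider (proj₁ (catalanWords-sound {n} w∈′)) a (proj₂ (catalanWords-sound {n} w∈′))

  nonempties⁺ : ∀ {n a w} → IsAvoider n (a ∷ w) → a ∷ w ∈ nonempties n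
  nonempties⁺ h@(avoider _ _ refl) = avoiders⁺ h

  nonempties⁻ : ∀ n {w} → w ∈ nonempties n → IsAvoider n w × w ≢ []
  nonempties⁻ (suc n) w∈ = h , λ { refl → 0≢1+n (IsAvoider.length≡ h) }
    where
    h = avoiders⁻ {suc n} w∈

  avoiders-unique : ∀ n → Unique (avoiders n)
  avoiders-unique n = Unique.filter⁺ (avoids? _<?_ _>?_) (catalanWords-unique n)

  nonempties-unique : ∀ n → Unique (nonempties n)
  nonempties-unique zero    = []
  nonempties-unique (suc n) = avoiders-unique (suc n)

  unpeaked-unique : ∀ n → Unique (unpeaked n)
  unpeaked-unique n = Unique.filter⁺ (¬? ∘ peaked? 0) (nonempties-unique n)

  -- Both lists are duplicate-free, so having the same members makes them permutations of each
  -- other. `rise` preserves and reflects being Catalan and avoiding peaks.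
  peaked↭rise : ∀ n → filter (peaked? 0) (avoiders (suc n)) ↭ map (rise 0) (avoiders n)
  peaked↭rise n = ∼bag⇒↭ (unique∧set⇒bag
    (Unique.filter⁺ (peaked? 0) (avoiders-unique (suc n)))
    (Unique.map⁺ (rise-injective 0 _ _) (avoiders-unique n))
    (mk⇔ to from))
    where
    to : ∀ {w} → w ∈ filter (peaked? 0) (avoiders (suc n)) → w ∈ map (rise 0) (avoiders n)
    to w∈ with ∈-filter⁻ (peaked? 0) {xs = avoiders (suc n)} w∈
    ... | w∈′ , p with peaked⇒rise p | avoiders⁻ {suc n} w∈′
    ... | t , refl | avoider c a l = ∈-map⁺ (rise 0) (avoiders⁺
            (avoider (rise-isCatalan⁻ t c) (a ∘ hasPeak-rise⁺ 0)
                     (suc-injective (trans (sym (length-rise 0 t)) l))))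
    from : ∀ {w} → w ∈ map (rise 0) (avoiders n) → w ∈ filter (peaked? 0) (avoiders (suc n))
    from w∈ with ∈-map⁻ (rise 0) w∈
    ... | t , t∈ , refl with avoiders⁻ {n} t∈
    ... | avoider c a l = ∈-filter⁺ (peaked? 0) (avoiders⁺
            (avoider (rise-isCatalan⁺ c) (a ∘ hasPeak-rise⁻ 0 t)
                     (trans (length-rise 0 t) (cong suc l))))
            (rise-peaked 0 t)

  block : ℕ → ℕ → List (Word × Word)
  block n k = cartesianProduct (unpeaked k) (nonempties (n ∸ k))

  -- The three groups, with `u` empty, only `v` empty, and neither empty, become the three summands
  -- of `C-suc`. Using `nonempties` in the second group keeps the pair of empty words from being
  -- listed twice.
  nonempty-pairs pairs : ℕ → List (Word × Word)
  nonempty-pairs n = concatMap (block n) (upTo (suc n))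
  pairs n = map ([] ,_) (avoiders n) ++ map (_, []) (nonempties n) ++ nonempty-pairs n

  unpeaked⁻ : ∀ n {w} → w ∈ unpeaked n → IsAvoider n w × w ≢ [] × ¬ Peaked 0 w
  unpeaked⁻ n w∈ with ∈-filter⁻ (¬? ∘ peaked? 0) {xs = nonempties n} w∈
  ... | w∈′ , p = proj₁ (nonempties⁻ n w∈′) , proj₂ (nonempties⁻ n w∈′) , p

  nonempty-pairs⁻ : ∀ n {u v} → (u , v) ∈ nonempty-pairs n →
                    ∃ λ k → k ≤ n × u ∈ unpeaked k × v ∈ nonempties (n ∸ k)
  nonempty-pairs⁻ n uv∈
    with ∈-concat⁻′ (map (block n) (upTo (suc n))) uv∈
  ... | _ , uv∈′ , xs∈ with ∈-map⁻ (block n) xs∈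
  ... | k , k∈ , refl with ∈-cartesianProduct⁻ (unpeaked k) (nonempties (n ∸ k)) uv∈′
  ... | u∈ , v∈ = k , s≤s⁻¹ (∈-upTo⁻ k∈) , u∈ , v∈

  pairs⁻ : ∀ n {u v} → (u , v) ∈ pairs n →
           (u ≡ [] × v ∈ avoiders n) ⊎ (v ≡ [] × u ∈ nonempties n) ⊎ ((u , v) ∈ nonempty-pairs n)
  pairs⁻ n uv∈ with ∈-++⁻ (map ([] ,_) (avoiders n)) uv∈
  ... | inj₁ p with ∈-map⁻ ([] ,_) p
  ...   | _ , v∈ , refl = inj₁ (refl , v∈)
  pairs⁻ n uv∈ | inj₂ p with ∈-++⁻ (map (_, []) (nonempties n)) p
  ... | inj₂ q = inj₂ (inj₂ q)
  ... | inj₁ q with ∈-map⁻ (_, []) q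
  ...   | _ , u∈ , refl = inj₂ (inj₁ (refl , u∈))

  nonempty-pairs-unique : ∀ n → Unique (nonempty-pairs n)
  nonempty-pairs-unique n = Unique.concat⁺ {xss = map (block n) (upTo (suc n))}
    (All.map⁺ {xs = upTo (suc n)} (All.tabulate λ {k} _ →
      Unique.cartesianProduct⁺ (unpeaked-unique k) (nonempties-unique (n ∸ k))))
    (AllPairs.map⁺ {xs = upTo (suc n)} (AllPairs.map (λ {k} {l} → disjoint {k} {l}) (Unique.upTo⁺ (suc n))))
    where
    disjoint : ∀ {k l} → k ≢ l →
               Disjoint (block n k) (block n l)
    -- A pair in both blocks would have a first word of length `k` and of length `l`.
    disjoint {k} {l} k≢l (p , q) = k≢l (trans
      (sym (IsAvoider.length≡ (proj₁ (unpeaked⁻ k (proj₁ (∈-cartesianProduct⁻ (unpeaked k) _ p))))))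
      (IsAvoider.length≡ (proj₁ (unpeaked⁻ l (proj₁ (∈-cartesianProduct⁻ (unpeaked l) _ q))))))

  pairs-unique : ∀ n → Unique (pairs n)
  pairs-unique n = Unique.++⁺
    (Unique.map⁺ (cong proj₂) (avoiders-unique n))
    (Unique.++⁺ (Unique.map⁺ (cong proj₁) (nonempties-unique n)) (nonempty-pairs-unique n) disjoint₂)
    disjoint₁
    where
    disjoint₂ : Disjoint (map (_, []) (nonempties n)) (nonempty-pairs n)
    disjoint₂ (p , q) with ∈-map⁻ (_, []) p
    ... | _ , _ , refl with nonempty-pairs⁻ n q
    ... | k , _ , _ , v∈ = proj₂ (nonempties⁻ (n ∸ k) v∈) refl
    disjoint₁ : Disjoint (map ([] ,_) (avoiders n)) (map (_, []) (nonempties n) ++ nonempty-pairs n)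
    disjoint₁ (p , q) with ∈-map⁻ ([] ,_) p
    ... | _ , _ , refl with ∈-++⁻ (map (_, []) (nonempties n)) q
    ...   | inj₂ r = let k , _ , u∈ , _ = nonempty-pairs⁻ n r in proj₁ (proj₂ (unpeaked⁻ k u∈)) refl
    ...   | inj₁ r with ∈-map⁻ (_, []) r
    ...     | _ , u∈ , refl = proj₂ (nonempties⁻ n u∈) refl

  -- Injectivity is asked only on listed elements: `join` is not injective on arbitrary pairs, only
  -- on those whose second word is Catalan.
  map-unique : ∀ {A B : Set} (f : A → B) {xs} →
               (∀ {a b} → a ∈ xs → b ∈ xs → f a ≡ f b → a ≡ b) → Unique xs → Unique (map f xs)
  map-unique f inj []        = []
  map-unique f inj (a∉ ∷ u) =
    All.map⁺ (All.tabulate λ b∈ eq → All.lookup a∉ b∈ (inj (here refl) (there b∈) eq))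
      ∷ map-unique f (λ a∈ b∈ → inj (there a∈) (there b∈)) u

  -- Returns `IsCatalan v` as well, for use in `join-injective`. When both words are nonempty,
  -- `hasPeak-++-0∷` locates any peak, and each location contradicts a condition on `u` or `v`.
  pairs⁻-join : ∀ n {u v} → (u , v) ∈ pairs n → IsCatalan v × IsAvoider (suc n) (join u v)
  pairs⁻-join n {u} {v} uv∈ with pairs⁻ n uv∈
  ... | inj₁ (refl , v∈) = c , avoider (join-isCatalan empty c) (a ∘ hasPeak-0∷⁻ c) (cong suc l)
    where open IsAvoider (avoiders⁻ {n} v∈) renaming (isCatalan to c; avoids to a; length≡ to l)
  ... | inj₂ (inj₁ (refl , u∈)) = empty , subst (IsAvoider (suc n)) (cong (0 ∷_) (sym (++-identityʳ _)))
      (avoider (start (isCatalan⇒steps-0∷ c)) (a ∘ hasPeak-join⁻ˡ c) (cong suc (trans (length-map suc u) l)))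
    where open IsAvoider (proj₁ (nonempties⁻ n u∈)) renaming (isCatalan to c; avoids to a; length≡ to l)
  ... | inj₂ (inj₂ p) with nonempty-pairs⁻ n p
  ... | k , k≤n , u∈ , v∈ with u | v | unpeaked⁻ k u∈ | nonempties⁻ (n ∸ k) v∈
  ... | []    | _ | _ , u≢[] , _ | _ = ⊥-elim (u≢[] refl)
  ... | _ ∷ _ | [] | _ | _ , v≢[] = ⊥-elim (v≢[] refl)
  ... | a ∷ u′ | _ ∷ v′ | avoider cu au lu , _ , ¬p | avoider (start l) av lv , _ =
    start l , avoider (join-isCatalan cu (start l)) avoids
      (cong suc (trans (length-++ (map suc (a ∷ u′)))
        (trans (cong₂ _+_ (trans (length-map suc (a ∷ u′)) lu) lv) (m+[n∸m]≡n k≤n))))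
    where
    avoids : ¬ HasPeak (join (a ∷ u′) (0 ∷ v′))
    avoids h with hasPeak-++-0∷ 0 a u′ v′ (isCatalan⇒steps-0∷ cu) h
    ... | inj₁ h′        = au (hasPeak-join⁻ˡ cu h′)
    ... | inj₂ (inj₁ h′) = ¬p h′
    ... | inj₂ (inj₂ h′) = av h′

  -- `first-return` supplies the inverse of `join`. Avoidance passes to both factors, and
  -- `peaked⇒hasPeak` shows that `u` is unpeaked whenever `v` is nonempty.
  avoiders↭pairs : ∀ n → avoiders (suc n) ↭ map (uncurry join) (pairs n)
  avoiders↭pairs n = ∼bag⇒↭ (unique∧set⇒bag
    (avoiders-unique (suc n))
    (map-unique (uncurry join)
      (λ p q eq → uncurry (cong₂ _,_)
        (join-injective _ _ (proj₁ (pairs⁻-join n p)) (proj₁ (pairs⁻-join n q)) (∷-injectiveʳ eq)))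
      (pairs-unique n))
    (mk⇔ to from))
    where
    from : ∀ {w} → w ∈ map (uncurry join) (pairs n) → w ∈ avoiders (suc n)
    from w∈ with ∈-map⁻ (uncurry join) w∈
    ... | _ , uv∈ , refl = avoiders⁺ (proj₂ (pairs⁻-join n uv∈))

    ∈-pairs : ∀ u v → IsCatalan u → IsCatalan v → ¬ HasPeak (join u v) →
              length (map suc u ++ v) ≡ n → (u , v) ∈ pairs n
    ∈-pairs [] v cu cv av l = ∈-++⁺ˡ (∈-map⁺ ([] ,_) (avoiders⁺ (avoider cv (av ∘ there) l)))
    ∈-pairs u@(_ ∷ _) [] cu cv av l = ∈-++⁺ʳ (map ([] ,_) (avoiders n)) (∈-++⁺ˡ (∈-map⁺ (_, [])
      (nonempties⁺ (avoider cu (av ∘ there ∘ hasPeak-++⁺ˡ [] ∘ hasPeak-map-suc⁺)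
        (trans (sym (length-map suc u)) (trans (cong length (sym (++-identityʳ (map suc u)))) l))))))
    ∈-pairs u@(_ ∷ _) v@(0 ∷ v′) cu cv av l =
      ∈-++⁺ʳ (map ([] ,_) (avoiders n)) (∈-++⁺ʳ (map (_, []) (nonempties n))
        (∈-concat⁺′
          (∈-cartesianProduct⁺
            (∈-filter⁺ (¬? ∘ peaked? 0)
              (nonempties⁺ (avoider cu (av ∘ there ∘ hasPeak-++⁺ˡ v ∘ hasPeak-map-suc⁺) refl))
              (av ∘ peaked⇒hasPeak 0 u v′))
            (nonempties⁺ (avoider cv (av ∘ hasPeak-++⁺ʳ (0 ∷ map suc u)) |v|≡)))
          (∈-map⁺ (block n)
            (∈-upTo⁺ (s≤s (subst (length u ≤_) |u|+|v|≡n (m≤m+n _ _)))))))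
      where
      |u|+|v|≡n : length u + length v ≡ n
      |u|+|v|≡n = trans (cong (_+ length v) (sym (length-map suc u)))
                        (trans (sym (length-++ (map suc u))) l)
      |v|≡ : length v ≡ n ∸ length u
      |v|≡ = trans (sym (m+n∸m≡n (length u) (length v))) (cong (_∸ length u) |u|+|v|≡n)

    to : ∀ {w} → w ∈ avoiders (suc n) → w ∈ map (uncurry join) (pairs n)
    to w∈ with avoiders⁻ {suc n} w∈
    ... | avoider (start {t} l) a len with first-return t l
    ... | u , v , refl , l′ , cv = ∈-map⁺ (uncurry join)
            (∈-pairs u v (steps-0∷⇒isCatalan l′) cv a (suc-injective len))

open Words

-- Finite sums over lists in a commutative ring.

module ListSum {c ℓ} (R : CommutativeRing c ℓ) where

  open CommutativeRing R
  open import Algebra.Properties.CommutativeSemigroup +-commutativeSemigroup using (x∙yz≈y∙xz)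
  open ≈-Reasoning setoid

  private variable
    A B : Set

  sum : List Carrier → Carrier
  sum = foldr _+_ 0#

  sum-++ : ∀ as bs → sum (as ++ bs) ≈ sum as + sum bs
  sum-++ []       bs = sym (+-identityˡ _)
  sum-++ (a ∷ as) bs = trans (+-congˡ (sum-++ as bs)) (sym (+-assoc _ _ _))

  sum-↭ : ∀ {as bs} → as ↭ bs → sum as ≈ sum bs
  sum-↭ ↭.refl         = refl
  sum-↭ (↭.prep a p)   = +-congˡ (sum-↭ p)
  sum-↭ (↭.swap a b p) = trans (x∙yz≈y∙xz _ _ _) (+-congˡ (+-congˡ (sum-↭ p)))
  sum-↭ (↭.trans p q)  = trans (sum-↭ p) (sum-↭ q)

  sum-map-cong : ∀ {f g : A → Carrier} xs → (∀ {a} → a ∈ xs → f a ≈ g a) →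
                 sum (map f xs) ≈ sum (map g xs)
  sum-map-cong []       p = refl
  sum-map-cong (x ∷ xs) p = +-cong (p (here ≡.refl)) (sum-map-cong xs (p ∘ there))

  sum-map-*ˡ : ∀ a (f : A → Carrier) xs → sum (map (λ x → a * f x) xs) ≈ a * sum (map f xs)
  sum-map-*ˡ a f []       = sym (zeroʳ a)
  sum-map-*ˡ a f (x ∷ xs) = trans (+-congˡ (sum-map-*ˡ a f xs)) (sym (distribˡ _ _ _))

  sum-map-filter : ∀ {p} {P : Pred A p} (P? : Decidable P) (f : A → Carrier) xs →
    sum (map f xs) ≈ sum (map f (filter P? xs)) + sum (map f (filter (¬? ∘ P?) xs))
  sum-map-filter P? f []       = sym (+-identityˡ _)
  sum-map-filter P? f (x ∷ xs) with P? x
  ... | yes _ = trans (+-congˡ (sum-map-filter P? f xs)) (sym (+-assoc _ _ _))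
  ... | no  _ = trans (+-congˡ (sum-map-filter P? f xs)) (x∙yz≈y∙xz _ _ _)

  sum-map-concatMap : ∀ (f : B → Carrier) (g : A → List B) xs →
    sum (map f (concatMap g xs)) ≈ sum (map (λ x → sum (map f (g x))) xs)
  sum-map-concatMap f g []       = refl
  sum-map-concatMap f g (x ∷ xs) = begin
    sum (map f (g x ++ concatMap g xs))           ≡⟨ cong sum (map-++ f (g x) _) ⟩
    sum (map f (g x) ++ map f (concatMap g xs))   ≈⟨ sum-++ (map f (g x)) _ ⟩
    sum (map f (g x)) + sum (map f (concatMap g xs)) ≈⟨ +-congˡ (sum-map-concatMap f g xs) ⟩
    sum (map f (g x)) + sum (map (λ x → sum (map f (g x))) xs) ∎

  sum-map-cartesianProduct : ∀ (f : A → Carrier) (g : B → Carrier) xs ys →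
    sum (map (λ (a , b) → f a * g b) (cartesianProduct xs ys)) ≈ sum (map f xs) * sum (map g ys)
  sum-map-cartesianProduct f g []       ys = sym (zeroˡ _)
  sum-map-cartesianProduct f g (x ∷ xs) ys = begin
    sum (map h (map (x ,_) ys ++ cartesianProduct xs ys))
      ≡⟨ cong sum (map-++ h (map (x ,_) ys) _) ⟩
    sum (map h (map (x ,_) ys) ++ map h (cartesianProduct xs ys))
      ≈⟨ sum-++ (map h (map (x ,_) ys)) _ ⟩
    sum (map h (map (x ,_) ys)) + sum (map h (cartesianProduct xs ys))
      ≈⟨ +-cong (trans (reflexive (cong sum (≡.sym (map-∘ ys)))) (sum-map-*ˡ (f x) g ys))
                (sum-map-cartesianProduct f g xs ys) ⟩
    f x * sum (map g ys) + sum (map f xs) * sum (map g ys)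
      ≈⟨ distribʳ _ _ _ ⟨
    sum (map f (x ∷ xs)) * sum (map g ys) ∎
    where h = λ (a , b) → f a * g b

-- Weights of words and the functional equation.

module ΣP = ListSum polyRing

weight : Word → Poly
weight w = y^ₚ des w

-- gf avoiders is C _<?_ _>?_ by definition.
gf : (ℕ → List Word) → Series
gf L n = sumₚ (map weight (L n))

0∷-*ₚ : ∀ p q → (0ℤ ∷ p) *ₚ q ≈ₚ 0ℤ ∷ p *ₚ q
0∷-*ₚ p q k = begin
  coeff (map (0ℤ ℤ.*_) q +ₚ (0ℤ ∷ p *ₚ q)) k           ≡⟨ coeff-+ₚ (map (0ℤ ℤ.*_) q) _ k ⟩
  coeff (map (0ℤ ℤ.*_) q) k ℤ.+ coeff (0ℤ ∷ p *ₚ q) k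
    ≡⟨ cong (ℤ._+ coeff (0ℤ ∷ p *ₚ q) k) (coeff-map (0ℤ ℤ.*_) ≡.refl q k) ⟩
  0ℤ ℤ.+ coeff (0ℤ ∷ p *ₚ q) k                         ≡⟨ ℤ.+-identityˡ _ ⟩
  coeff (0ℤ ∷ p *ₚ q) k                                ∎
  where open ≡.≡-Reasoning

y^-+ : ∀ m n → y^ₚ (m ℕ.+ n) ≈ₚ y^ₚ m *ₚ y^ₚ n
y^-+ zero    n k       = ≡.sym (P.*-identityˡ (y^ₚ n) k)
y^-+ (suc m) n zero    = ≡.sym (0∷-*ₚ (y^ₚ m) (y^ₚ n) zero)
y^-+ (suc m) n (suc k) = ≡.trans (y^-+ m n k) (≡.sym (0∷-*ₚ (y^ₚ m) (y^ₚ n) (suc k)))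

weight-join : ∀ {u v} → IsCatalan u → u ≢ [] → IsCatalan v → v ≢ [] →
              weight (join u v) ≈ₚ y^ₚ 1 *ₚ (weight u *ₚ weight v)
weight-join {u} {v} cu u≢[] cv v≢[] k = begin
  coeff (weight (join u v)) k              ≡⟨ cong (λ d → coeff (y^ₚ d) k) (des-join cu u≢[] cv v≢[]) ⟩
  coeff (y^ₚ suc (des u ℕ.+ des v)) k      ≡⟨ y^-+ 1 (des u ℕ.+ des v) k ⟩
  coeff (y^ₚ 1 *ₚ y^ₚ (des u ℕ.+ des v)) k
    ≡⟨ P.*-cong {x = y^ₚ 1} {y = y^ₚ 1} {u = y^ₚ (des u ℕ.+ des v)}
         {v = weight u *ₚ weight v} (λ _ → ≡.refl) (y^-+ (des u) (des v)) k ⟩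
  coeff (y^ₚ 1 *ₚ (weight u *ₚ weight v)) k ∎
  where open ≡.≡-Reasoning

-- Block `k` contributes coefficient `k` of one series times coefficient `n ∸ k` of the other, so
-- the blocks together form a Cauchy product. The factor `y^ₚ 1` records the junction descent.
sum-nonempty-pairs : ∀ n → sumₚ (map (weight ∘ uncurry join) (nonempty-pairs n))
                             ≈ₚ y^ₚ 1 *ₚ (gf unpeaked *ˢ gf nonempties) n
sum-nonempty-pairs n k = begin
  coeff (sumₚ (map weight′ (nonempty-pairs n))) k
    ≡⟨ ΣP.sum-map-concatMap weight′ (block n) (upTo (suc n)) k ⟩
  coeff (sumₚ (map (λ i → sumₚ (map weight′ (block n i))) (upTo (suc n)))) k
    ≡⟨ ΣP.sum-map-cong {f = λ i → sumₚ (map weight′ (block n i))} {g = λ i → y^ₚ 1 *ₚ product i}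
         (upTo (suc n)) (λ {i} _ → sum-block i) k ⟩
  coeff (sumₚ (map (λ i → y^ₚ 1 *ₚ product i) (upTo (suc n)))) k
    ≡⟨ ΣP.sum-map-*ˡ (y^ₚ 1) product (upTo (suc n)) k ⟩
  coeff (y^ₚ 1 *ₚ (gf unpeaked *ˢ gf nonempties) n) k ∎
  where
  open ≡.≡-Reasoning
  weight′ : Word × Word → Poly
  weight′ = weight ∘ uncurry join
  product : ℕ → Poly
  product i = gf unpeaked i *ₚ gf nonempties (n ∸ i)
  weights : Word × Word → Poly
  weights (u , v) = weight u *ₚ weight v
  pointwise : ∀ i {uv} → uv ∈ block n i → weight′ uv ≈ₚ y^ₚ 1 *ₚ weights uv
  pointwise i {u , v} uv∈ with ∈-cartesianProduct⁻ (unpeaked i) (nonempties (n ∸ i)) uv∈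
  ... | u∈ , v∈ with unpeaked⁻ i u∈ | nonempties⁻ (n ∸ i) v∈
  ... | hu , u≢[] , _ | hv , v≢[] =
    weight-join (IsAvoider.isCatalan hu) u≢[] (IsAvoider.isCatalan hv) v≢[]
  sum-block : ∀ i → sumₚ (map weight′ (block n i)) ≈ₚ y^ₚ 1 *ₚ product i
  sum-block i k = begin
    coeff (sumₚ (map weight′ (block n i))) k
      ≡⟨ ΣP.sum-map-cong {f = weight′} {g = λ uv → y^ₚ 1 *ₚ weights uv} (block n i) (pointwise i) k ⟩
    coeff (sumₚ (map (λ uv → y^ₚ 1 *ₚ weights uv) (block n i))) k
      ≡⟨ ΣP.sum-map-*ˡ (y^ₚ 1) weights (block n i) k ⟩
    coeff (y^ₚ 1 *ₚ sumₚ (map weights (block n i))) k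
      ≡⟨ P.*-cong {x = y^ₚ 1} {y = y^ₚ 1} {u = sumₚ (map weights (block n i))} {v = product i} (λ _ → ≡.refl)
           (ΣP.sum-map-cartesianProduct weight weight (unpeaked i) (nonempties (n ∸ i))) k ⟩
    coeff (y^ₚ 1 *ₚ product i) k ∎

-- One summand for each group of `pairs`. In the first two groups `join` creates no descent, so the
-- weight is that of the single nontrivial factor.
C-suc : ∀ n → C _<?_ _>?_ (suc n) ≈ₚ
          C _<?_ _>?_ n +ₚ (gf nonempties n +ₚ y^ₚ 1 *ₚ (gf unpeaked *ˢ gf nonempties) n)
C-suc n k = begin
  coeff (sumₚ (map weight (avoiders (suc n)))) k
    ≡⟨ ΣP.sum-↭ (↭-map⁺ weight (avoiders↭pairs n)) k ⟩
  coeff (sumₚ (map weight (map (uncurry join) (pairs n)))) k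
    ≡⟨ cong (λ ps → coeff (sumₚ ps) k) (map-∘ (pairs n)) ⟨
  coeff (sumₚ (map weight′ (pairs n))) k
    ≡⟨ sum-map-++ (map ([] ,_) (avoiders n)) (map (_, []) (nonempties n) ++ nonempty-pairs n) k ⟩
  coeff (sumₚ (map weight′ (map ([] ,_) (avoiders n)))) k
    ℤ.+ coeff (sumₚ (map weight′ (map (_, []) (nonempties n) ++ nonempty-pairs n))) k
    ≡⟨ cong₂ ℤ._+_
         (sum-map-map ([] ,_) (avoiders n)
           (λ v∈ → des-0∷ (IsAvoider.isCatalan (avoiders⁻ {n} v∈))) k)
         (sum-map-++ (map (_, []) (nonempties n)) (nonempty-pairs n) k) ⟩
  coeff (C _<?_ _>?_ n) k
    ℤ.+ (coeff (sumₚ (map weight′ (map (_, []) (nonempties n)))) k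
         ℤ.+ coeff (sumₚ (map weight′ (nonempty-pairs n))) k)
    ≡⟨ cong (ℤ._+_ (coeff (C _<?_ _>?_ n) k)) (cong₂ ℤ._+_
         (sum-map-map (_, []) (nonempties n)
           (λ {u} u∈ → ≡.trans (cong (des ∘ (0 ∷_)) (++-identityʳ (map suc u)))
             (des-0∷map-suc (IsAvoider.isCatalan (proj₁ (nonempties⁻ n u∈))))) k)
         (sum-nonempty-pairs n k)) ⟩
  coeff (C _<?_ _>?_ n) k
    ℤ.+ (coeff (gf nonempties n) k ℤ.+ coeff (y^ₚ 1 *ₚ (gf unpeaked *ˢ gf nonempties) n) k)
    ≡⟨ cong (ℤ._+_ (coeff (C _<?_ _>?_ n) k)) (coeff-+ₚ (gf nonempties n) _ k) ⟨
  coeff (C _<?_ _>?_ n) k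
    ℤ.+ coeff (gf nonempties n +ₚ y^ₚ 1 *ₚ (gf unpeaked *ˢ gf nonempties) n) k
    ≡⟨ coeff-+ₚ (C _<?_ _>?_ n) _ k ⟨
  coeff (C _<?_ _>?_ n +ₚ (gf nonempties n +ₚ y^ₚ 1 *ₚ (gf unpeaked *ˢ gf nonempties) n)) k ∎
  where
  open ≡.≡-Reasoning
  weight′ : Word × Word → Poly
  weight′ = weight ∘ uncurry join
  sum-map-++ : ∀ xs ys k → coeff (sumₚ (map weight′ (xs ++ ys))) k
                             ≡ coeff (sumₚ (map weight′ xs)) k ℤ.+ coeff (sumₚ (map weight′ ys)) k
  sum-map-++ xs ys k = ≡.trans (cong (λ ps → coeff (sumₚ ps) k) (map-++ weight′ xs ys))
    (≡.trans (ΣP.sum-++ (map weight′ xs) (map weight′ ys) k)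
             (coeff-+ₚ (sumₚ (map weight′ xs)) (sumₚ (map weight′ ys)) k))
  sum-map-map : ∀ (f : Word → Word × Word) ws → (∀ {w} → w ∈ ws → des (uncurry join (f w)) ≡ des w) →
                sumₚ (map weight′ (map f ws)) ≈ₚ sumₚ (map weight ws)
  sum-map-map f ws p k = ≡.trans (cong (λ ps → coeff (sumₚ ps) k) (≡.sym (map-∘ ws)))
    (ΣP.sum-map-cong {f = weight′ ∘ f} {g = weight} ws (λ w∈ k → cong (λ d → coeff (y^ₚ d) k) (p w∈)) k)

x-*ˢ-suc : ∀ f n → (x *ˢ f) (suc n) ≈ₚ f n
x-*ˢ-suc f n k = begin
  coeff ((x *ˢ f) (suc n)) k                ≡⟨ *ˢ≈⊛ x f (suc n) k ⟩
  coeff ((x ∘ suc P[[x]].⊛ f) n) k          ≡⟨ P[[x]].⊛-cong {g = f} x∘suc≈1 (λ _ _ → ≡.refl) n k ⟩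
  coeff ((P[[x]].const 1ₚ P[[x]].⊛ f) n) k  ≡⟨ P[[x]].⊛-identityˡ f n k ⟩
  coeff (f n) k                             ∎
  where
  open ≡.≡-Reasoning
  x∘suc≈1 : x ∘ suc ≈ˢ P[[x]].const 1ₚ
  x∘suc≈1 zero    _ = ≡.refl
  x∘suc≈1 (suc _) _ = ≡.refl

-- The subtracted 1 is the weight of the empty word.
C-1≈gf-nonempties : C _<?_ _>?_ -ˢ 1ˢ ≈ˢ gf nonempties
C-1≈gf-nonempties zero    zero    = ≡.refl
C-1≈gf-nonempties zero    (suc k) = ≡.refl
C-1≈gf-nonempties (suc n)         = P.+-identityʳ (gf avoiders (suc n))

-- Splits by `peaked? 0`. The peaked words are the images under `rise 0` of the avoiders one letter
-- shorter, with unchanged weight, which accounts for the term `x *ˢ C`.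
gf-nonempties : gf nonempties ≈ˢ x *ˢ C _<?_ _>?_ +ˢ gf unpeaked
gf-nonempties zero    k = ≡.refl
gf-nonempties (suc n) k = begin
  coeff (gf nonempties (suc n)) k
    ≡⟨ ΣP.sum-map-filter (peaked? 0) weight (avoiders (suc n)) k ⟩
  coeff (sumₚ (map weight (filter (peaked? 0) (avoiders (suc n)))) +ₚ gf unpeaked (suc n)) k
    ≡⟨ P.+-cong {x = sumₚ (map weight (filter (peaked? 0) (avoiders (suc n))))} {y = (x *ˢ c) (suc n)}
         {u = gf unpeaked (suc n)} {v = gf unpeaked (suc n)} sum-peaked (λ _ → ≡.refl) k ⟩
  coeff ((x *ˢ c +ˢ gf unpeaked) (suc n)) k ∎
  where
  open ≡.≡-Reasoning
  c = C _<?_ _>?_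
  sum-peaked : sumₚ (map weight (filter (peaked? 0) (avoiders (suc n)))) ≈ₚ (x *ˢ c) (suc n)
  sum-peaked k = begin
    coeff (sumₚ (map weight (filter (peaked? 0) (avoiders (suc n))))) k
      ≡⟨ ΣP.sum-↭ (↭-map⁺ weight (peaked↭rise n)) k ⟩
    coeff (sumₚ (map weight (map (rise 0) (avoiders n)))) k
      ≡⟨ cong (λ ps → coeff (sumₚ ps) k) (map-∘ (avoiders n)) ⟨
    coeff (sumₚ (map (weight ∘ rise 0) (avoiders n))) k
      ≡⟨ ΣP.sum-map-cong {f = weight ∘ rise 0} {g = weight} (avoiders n)
           (λ {w} _ k → cong (λ d → coeff (y^ₚ d) k) (des-rise 0 w)) k ⟩
    coeff (c n) k
      ≡⟨ x-*ˢ-suc c n k ⟨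
    coeff ((x *ˢ c) (suc n)) k ∎

C-1-xC≈gf-unpeaked : C _<?_ _>?_ -ˢ 1ˢ -ˢ x *ˢ C _<?_ _>?_ ≈ˢ gf unpeaked
C-1-xC≈gf-unpeaked n k = ≡.trans
  (S.+-cong {x = c -ˢ 1ˢ} {y = x *ˢ c +ˢ gf unpeaked} {u = S.- (x *ˢ c)} {v = S.- (x *ˢ c)}
    (λ n k → ≡.trans (C-1≈gf-nonempties n k) (gf-nonempties n k)) (λ _ _ → ≡.refl) n k)
  (xyx⁻¹≈y (x *ˢ c) (gf unpeaked) n k)
  where
  open import Algebra.Properties.AbelianGroup S.+-abelianGroup using (xyx⁻¹≈y)
  c = C _<?_ _>?_

y-*ˢ : ∀ f n → (y *ˢ f) n ≈ₚ y^ₚ 1 *ₚ f n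
y-*ˢ f n k = begin
  coeff ((y *ˢ f) n) k                         ≡⟨ *ˢ≈⊛ y f n k ⟩
  coeff ((y P[[x]].⊛ f) n) k
    ≡⟨ P[[x]].⊛-cong {g = f} (constant≈const (y^ₚ 1)) (λ _ _ → ≡.refl) n k ⟩
  coeff ((P[[x]].const (y^ₚ 1) P[[x]].⊛ f) n) k ≡⟨ P[[x]].const-⊛ (y^ₚ 1) f n k ⟩
  coeff (y^ₚ 1 *ₚ f n) k                       ∎
  where open ≡.≡-Reasoning

-- Multiplication by `x` shifts the index, which turns `C-suc` into an equation of series once
-- `gf nonempties` and `gf unpeaked` are expressed through `c`.
catalan-equation : let c = C _<?_ _>?_ in
  c ≈ˢ 1ˢ +ˢ x *ˢ (c +ˢ (c -ˢ 1ˢ) +ˢ y *ˢ ((c -ˢ 1ˢ -ˢ x *ˢ c) *ˢ (c -ˢ 1ˢ)))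
catalan-equation zero    k = ≡.refl
catalan-equation (suc n) k = begin
  coeff (c (suc n)) k
    ≡⟨ C-suc n k ⟩
  coeff (c n +ₚ (gf nonempties n +ₚ y^ₚ 1 *ₚ (gf unpeaked *ˢ gf nonempties) n)) k
    ≡⟨ P.+-assoc (c n) (gf nonempties n) (y^ₚ 1 *ₚ (gf unpeaked *ˢ gf nonempties) n) k ⟨
  coeff (c n +ₚ gf nonempties n +ₚ y^ₚ 1 *ₚ (gf unpeaked *ˢ gf nonempties) n) k
    ≡⟨ y-*ˢ-+ k ⟨
  coeff ((c +ˢ gf nonempties +ˢ y *ˢ (gf unpeaked *ˢ gf nonempties)) n) k
    ≡⟨ S.+-cong {x = c +ˢ (c -ˢ 1ˢ)} {y = c +ˢ gf nonempties}
         {u = y *ˢ h} {v = y *ˢ (gf unpeaked *ˢ gf nonempties)}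
         (S.+-cong {x = c} {y = c} {u = c -ˢ 1ˢ} {v = gf nonempties} (λ _ _ → ≡.refl) C-1≈gf-nonempties)
         (S.*-cong {x = y} {y = y} {u = h} {v = gf unpeaked *ˢ gf nonempties} (λ _ _ → ≡.refl)
           (S.*-cong {x = c -ˢ 1ˢ -ˢ x *ˢ c} {y = gf unpeaked} {u = c -ˢ 1ˢ} {v = gf nonempties}
             C-1-xC≈gf-unpeaked C-1≈gf-nonempties)) n k ⟨
  coeff ((c +ˢ (c -ˢ 1ˢ) +ˢ y *ˢ h) n) k
    ≡⟨ x-*ˢ-suc (c +ˢ (c -ˢ 1ˢ) +ˢ y *ˢ h) n k ⟨
  coeff ((1ˢ +ˢ x *ˢ (c +ˢ (c -ˢ 1ˢ) +ˢ y *ˢ h)) (suc n)) k ∎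
  where
  open ≡.≡-Reasoning
  c h : Series
  c = C _<?_ _>?_
  h = (c -ˢ 1ˢ -ˢ x *ˢ c) *ˢ (c -ˢ 1ˢ)
  y-*ˢ-+ : (c +ˢ gf nonempties +ˢ y *ˢ (gf unpeaked *ˢ gf nonempties)) n
             ≈ₚ c n +ₚ gf nonempties n +ₚ y^ₚ 1 *ₚ (gf unpeaked *ˢ gf nonempties) n
  y-*ˢ-+ = P.+-cong {x = c n +ₚ gf nonempties n} {y = c n +ₚ gf nonempties n}
             {u = (y *ˢ (gf unpeaked *ˢ gf nonempties)) n} {v = y^ₚ 1 *ₚ (gf unpeaked *ˢ gf nonempties) n}
             (λ _ → ≡.refl) (y-*ˢ (gf unpeaked *ˢ gf nonempties) n)

theorem3p7 : let Δ = 1ˢ -ˢ 4 · x +ˢ 4 · x ^ˢ 2 -ˢ 2 · x ^ˢ 2 *ˢ y +ˢ x ^ˢ 4 *ˢ y ^ˢ 2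
    in  ∃! _≈ˢ_ (IsSqrt Δ)
    × (∀ √Δ → IsSqrt Δ √Δ →
    2 · x *ˢ y *ˢ (1ˢ -ˢ x) *ˢ C _<?_ _>?_
    ≈ˢ 1ˢ -ˢ 2 · x +ˢ 2 · x *ˢ y -ˢ x ^ˢ 2 *ˢ y -ˢ √Δ)
theorem3p7 = (√Δ , isSqrt , λ {t} → sqrt-unique Δ √Δ t isSqrt)
           , λ s s-isSqrt → ℤ-Series.subtraction-swap (2A *ˢ C _<?_ _>?_) B s
                              (sqrt-unique Δ √Δ s isSqrt s-isSqrt)
  where
  Δ 2A B √Δ : Series
  Δ  = 1ˢ -ˢ 4 · x +ˢ 4 · x ^ˢ 2 -ˢ 2 · x ^ˢ 2 *ˢ y +ˢ x ^ˢ 4 *ˢ y ^ˢ 2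
  2A = 2 · x *ˢ y *ˢ (1ˢ -ˢ x)
  B  = 1ˢ -ˢ 2 · x +ˢ 2 · x *ˢ y -ˢ x ^ˢ 2 *ˢ y
  -- The generating function itself provides the square root: the equation for `C` makes this series
  -- square to `Δ`. Any other root then equals it by uniqueness, and the formula is a rearrangement.
  √Δ = B -ˢ 2A *ˢ C _<?_ _>?_
  isSqrt : IsSqrt Δ √Δ
  -- The constant term evaluates to `1ₚ`, since `2A` has constant term 0 and `B` has constant term
  -- 1.
  isSqrt = (λ _ → ≡.refl)
         , ℤ-Series.complete-square _·_ ·≈integer-* x y (C _<?_ _>?_) catalan-equation
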